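{- If $\Gamma$ is a Deza graph with parameters $(n,k,k-1,a)$, $k > 1$, and $\beta = 1$, then $\Gamma$ can be obtained either from Construction 1 or from Construction 2 (both described in the context below).
   Context: A Deza graph with parameters $(n,k,b,a)$ is a $k$-regular graph on $n$ vertices in which any two distinct vertices have either $a$ or $b$ ($a\le b$) common neighbours. For a vertex $v$, $\beta$ denotes the number of vertices $u$ with $|N(v)\cap N(u)|=b$; this number does not depend on $v$. Both constructions start from a strongly regular graph $\Delta$ with parameters $(m,\ell,\lambda,\mu)$ where $\lambda=\mu-1$, with adjacency matrix $B$. Construction 1: $\Gamma_1$ is the strong product of $K_2$ and $\Delta$, i.e. its adjacency matrix is $A_1 = B\otimes J_2 - I_{2m}$ ($J_2$ the $2\times 2$ all-ones matrix, $I_{2m}$ the identity matrix). It is a strictly Deza graph with parameters $(n,k,k-1,a)$ and $\beta=1$, where $n=2m$, $k=2\ell+1$, $a=2\mu$. Construction 2: assume $\Delta$ has an involutive automorphism that interchanges only non-adjacent vertices, with permutation matrix $P$. Let $P_1=P\otimes I_2$ and $A_2=P_1A_1$. Equivalently: take the strong product of $K_2$ with the graph of adjacency matrix $PB$ (dual Seidel switching of $\Delta$), and for every transposition $(x~y)$ of the involution, with corresponding vertex pairs $x',x''$ and $y',y''$, delete the edges $\{x',x''\}$, $\{y',y''\}$ and insert the edges $\{x',y''\}$, $\{x'',y'\}$. The resulting graph $\Gamma_2$ (adjacency matrix $A_2$, with $A_2^2=A_1^2$) is a strictly Deza graph with parameters $(n,k,k-1,a)$ and $\beta=1$, where $n=2m$,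 $k=2\ell+1$, $a=2\mu$. -}

module Defs where

open import Algebra.Definitions using (Involutive)
open import Data.Bool using (Bool; true; false; _∧_; _∨_; not)
open import Data.Bool.Properties using (∧-zeroʳ)
open import Data.Fin using (Fin; zero; _≟_)
open import Data.Fin.Subset using (Subset; _∩_; ∣_∣)
open import Data.Nat using (ℕ; suc; _≤_)
import Data.Nat as ℕ
open import Data.Product using (_×_; _,_; ∃₂; ∃-syntax; map₂; proj₂)
open import Data.Sum using (_⊎_)
open import Data.Vec using (tabulate)
open import Function.Bundles using (_↔_; Inverse; mk⇔)
open import Relation.Binary.PropositionalEquality
  using (_≡_; _≢_; refl; sym; trans; cong)
open import Relation.Nullary.Decidable using (does; does-⇔; dec-true)

-- Simple graphs, given by their symmetric 0-1 adjacency matrix with zero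
-- diagonal.
record Graph (V : Set) : Set where
  field
    adj         : V → V → Bool
    symmetric   : ∀ u v → adj u v ≡ adj v u
    irreflexive : ∀ v → adj v v ≡ false

open Graph public

record _≅_ {V W : Set} (Γ : Graph V) (Δ : Graph W) : Set where
  field
    bijection : V ↔ W
    preserves : ∀ u v →
      adj Δ (Inverse.to bijection u) (Inverse.to bijection v) ≡ adj Γ u v

N : ∀ {n} → Graph (Fin n) → Fin n → Subset n
N Γ v = tabulate (adj Γ v)

common : ∀ {n} → Graph (Fin n) → Fin n → Fin n → ℕ
common Γ u v = ∣ N Γ u ∩ N Γ v ∣

IsRegular : ∀ {n} → Graph (Fin n) → ℕ → Set
IsRegular Γ k = ∀ v → ∣ N Γ v ∣ ≡ k

-- Γ is a Deza graph with parameters (n , k , b , a).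
record IsDeza {n} (Γ : Graph (Fin n)) (k b a : ℕ) : Set where
  field
    a≤b     : a ≤ b
    regular : IsRegular Γ k
    a-or-b  : ∀ u v → u ≢ v → common Γ u v ≡ a ⊎ common Γ u v ≡ b

-- The number of u with ∣ N v ∩ N u ∣ = b.  The vertex v itself has
-- ∣ N v ∩ N v ∣ = k, so it is not counted as long as b ≠ k.
β : ∀ {n} → Graph (Fin n) → ℕ → Fin n → ℕ
β Γ b v = ∣ tabulate (λ u → does (common Γ v u ℕ.≟ b)) ∣

-- Δ is strongly regular with parameters (m , ℓ , e , μ); e is the usual λ.
-- As usual, complete and edgeless graphs are excluded.
record IsSRG {m} (Δ : Graph (Fin m)) (ℓ e μ : ℕ) : Set where
  field
    regular     : IsRegular Δ ℓ
    adjacent    : ∀ x y → adj Δ x y ≡ true → common Δ x y ≡ e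
    nonadjacent : ∀ x y → x ≢ y → adj Δ x y ≡ false → common Δ x y ≡ μ
    notEdgeless : ∃₂ λ x y → adj Δ x y ≡ true
    notComplete : ∃₂ λ x y → x ≢ y × adj Δ x y ≡ false

does-≟-sym : ∀ {n} (x y : Fin n) → does (x ≟ y) ≡ does (y ≟ x)
does-≟-sym x y = does-⇔ (mk⇔ sym sym) (x ≟ y) (y ≟ x)

K : ∀ n → Graph (Fin n)
K n = record
  { adj         = λ i j → not (does (i ≟ j))
  ; symmetric   = λ i j → cong not (does-≟-sym i j)
  ; irreflexive = λ i → cong not (dec-true (i ≟ i) refl)
  }

-- Strong product.
infixr 7 _⊠_
_⊠_ : ∀ {p q} → Graph (Fin p) → Graph (Fin q) → Graph (Fin p × Fin q)
_⊠_ {p} {q} Γ Δ = record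
  { adj         = adj⊠
  ; symmetric   = symm
  ; irreflexive = irr
  }
  where
  adj⊠ : Fin p × Fin q → Fin p × Fin q → Bool
  adj⊠ (i , x) (j , y) =
      (adj Γ i j ∧ does (x ≟ y))
    ∨ (does (i ≟ j) ∧ adj Δ x y)
    ∨ (adj Γ i j ∧ adj Δ x y)

  symm : ∀ u v → adj⊠ u v ≡ adj⊠ v u
  symm (i , x) (j , y)
    rewrite symmetric Γ i j | symmetric Δ x y
          | does-≟-sym x y | does-≟-sym i j = refl

  irr : ∀ v → adj⊠ v v ≡ false
  irr (i , x)
    rewrite irreflexive Γ i | irreflexive Δ x | ∧-zeroʳ (does (i ≟ i)) = refl

-- σ is an automorphism of order 2 interchanging only non-adjacent vertices.
record IsSwitchingInvolution {V : Set} (Γ : Graph V) (σ : V → V) : Set where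
  field
    automorphism : ∀ x y → adj Γ (σ x) (σ y) ≡ adj Γ x y
    involutive   : Involutive _≡_ σ
    nontrivial   : ∃[ x ] σ x ≢ x
    -- automatic at fixed points of σ
    interchanges : ∀ x → adj Γ x (σ x) ≡ false

-- Dual Seidel switching.  If A is the adjacency matrix of Γ and P is the
-- permutation matrix of σ (P x y = 1 iff y = σ x), then (P A) x y = A (σ x) y.
switch : ∀ {V} (Γ : Graph V) {σ : V → V} → IsSwitchingInvolution Γ σ → Graph V
switch Γ {σ} s = record
  { adj         = λ x y → adj Γ (σ x) y
  ; symmetric   = λ x y → trans (sym (automorphism (σ x) y))
      (trans (cong (λ z → adj Γ z (σ y)) (involutive x)) (symmetric Γ x (σ y)))
  ; irreflexive = λ x → trans (symmetric Γ (σ x) x) (interchanges x)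
  }
  where open IsSwitchingInvolution s

-- A₁ = (B + I) ⊗ J₂ − I, with the K₂-coordinate written first.
construction₁ : ∀ {m} → Graph (Fin m) → Graph (Fin 2 × Fin m)
construction₁ Δ = K 2 ⊠ Δ

-- P₁ = P ⊗ I₂ is the permutation matrix of map₂ σ.
lift-involution : ∀ {m} {Δ : Graph (Fin m)} {σ : Fin m → Fin m} →
  IsSwitchingInvolution Δ σ → IsSwitchingInvolution (construction₁ Δ) (map₂ σ)
lift-involution {m} {Δ} {σ} s = record
  { automorphism = aut
  ; involutive   = λ (i , x) → cong (i ,_) (involutive x)
  ; nontrivial   = let (x , σx≢x) = nontrivial in
                   (zero , x) , λ eq → σx≢x (cong proj₂ eq)
  ; interchanges = inter
  }
  where
  open IsSwitchingInvolution s

  σ-injective : ∀ {x y} → σ x ≡ σ y → x ≡ y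
  σ-injective {x} {y} eq =
    trans (sym (involutive x)) (trans (cong σ eq) (involutive y))

  aut : ∀ u v →
    adj (construction₁ Δ) (map₂ σ u) (map₂ σ v) ≡ adj (construction₁ Δ) u v
  aut (i , x) (j , y)
    rewrite automorphism x y
          | does-⇔ (mk⇔ σ-injective (cong σ)) (σ x ≟ σ y) (x ≟ y) = refl

  inter : ∀ v → adj (construction₁ Δ) v (map₂ σ v) ≡ false
  inter (i , x)
    rewrite irreflexive (K 2) i | interchanges x | ∧-zeroʳ (does (i ≟ i)) = refl

-- A₂ = P₁ A₁.
construction₂ : ∀ {m} (Δ : Graph (Fin m)) {σ : Fin m → Fin m} →
  IsSwitchingInvolution Δ σ → Graph (Fin 2 × Fin m)
construction₂ Δ s = switch (construction₁ Δ) (lift-involution s)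

-- The condition on Δ common to both constructions: λ = μ − 1.
IsBase : ∀ {m} → Graph (Fin m) → Set
IsBase Δ = ∃[ ℓ ] ∃[ e ] ∃[ μ ] (IsSRG Δ ℓ e μ × suc e ≡ μ)

FromConstruction₁ : ∀ {V} → Graph V → Set
FromConstruction₁ Γ =
  ∃[ m ] ∃[ Δ ] (IsBase {m} Δ × Γ ≅ construction₁ Δ)

FromConstruction₂ : ∀ {V} → Graph V → Set
FromConstruction₂ Γ =
  ∃[ m ] ∃[ Δ ] (IsBase {m} Δ ×
    ∃[ σ ] ∃[ s ] Γ ≅ construction₂ Δ {σ} s)

{-# OPTIONS --safe #-}
-- Every vertex v has a unique mate v′ with k − 1 common neighbours, and with
-- k − 1 = a + 1 + d and M the permutation matrix of the mates,
-- A² = a J + (2 + d) I + (1 + d) M.  Since A A² is symmetric, A commutes with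
-- M, i.e. mates form an automorphism.  Let f v be the only neighbour of v that
-- is not a neighbour of v′; f is an involution commuting with ′.  The common
-- neighbours of v and v′ form a union of pairs of mates, so counting the a
-- common neighbours of v and w modulo 2 gives a ≡ A (w, f v) + A (v, f w).
-- Taking suitable v, w shows that a is even, hence A (w, f v) = A (v, f w) and
-- g v = f v′ is an automorphism.  In the graph with adjacency matrix
-- A₁ (u, v) = A (g u, v) mates are adjacent twins, so it is the strong product
-- of K₂ and a graph Δ on the pairs of mates; counting shows that Δ is strongly
-- regular with λ = μ − 1, and Γ is recovered by switching back with g.
module Submission where

open import Defs
open import Data.Bool as Bool using (Bool; true; false; _∧_; not; if_then_else_)
open import Data.Bool.Properties using (∨-identityʳ; T-≡; not-involutive)
open import Data.Fin using (Fin; zero; suc; _≟_; toℕ; fromℕ<)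
open import Data.Fin.Permutation using (permutation)
open import Data.Fin.Properties as Fin using (toℕ-injective; any?)
open import Data.Fin.Subset using (_∩_; ∣_∣)
open import Data.Fin.Subset.Properties using (∩-comm; ∩-idem)
open import Data.Nat as ℕ
  using (ℕ; zero; suc; _+_; _*_; _∸_; _>_; NonZero; ⌊_/2⌋; _⊓_; _<?_; z≤n; s≤s)
open import Data.Nat.Properties hiding (_≟_)
open import Data.Nat.Tactic.RingSolver using (solve-∀)
open import Data.Product using (_×_; _,_; ∃-syntax; map₂; proj₁; proj₂)
open import Data.Sum using (_⊎_; inj₁; inj₂)
open import Data.Vec using (tabulate)
open import Function using (_∘_)
open import Function.Bundles using (mk⇔; mk↔ₛ′; Equivalence)
open import Relation.Binary.PropositionalEquality
open import Relation.Nullary using (Dec; yes; no; does; contradiction)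
open import Relation.Nullary.Decidable
  using (dec-true; dec-false; does-⇔; ¬?; _×-dec_; decidable-stable)

open import Algebra.Properties.Semiring.Sum +-*-semiring

-- Counting with sums of 0-1 values, and listing a decidable subset.

⟦_⟧ : Bool → ℕ
⟦ b ⟧ = if b then 1 else 0

⟦⟧-injective : ∀ {b c} → ⟦ b ⟧ ≡ ⟦ c ⟧ → b ≡ c
⟦⟧-injective {true}  {true}  _ = refl
⟦⟧-injective {false} {false} _ = refl

⟦⟧-idem : ∀ b → ⟦ b ⟧ * ⟦ b ⟧ ≡ ⟦ b ⟧
⟦⟧-idem true  = refl
⟦⟧-idem false = refl

∣tabulate∣ : ∀ {n} (b : Fin n → Bool) → ∣ tabulate b ∣ ≡ ∑[ i < n ] ⟦ b i ⟧
∣tabulate∣ {zero}  b = refl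
∣tabulate∣ {suc n} b with b zero
... | true  = cong suc (∣tabulate∣ (b ∘ suc))
... | false = ∣tabulate∣ (b ∘ suc)

∣tabulate-∩∣ : ∀ {n} (b c : Fin n → Bool) →
  ∣ tabulate b ∩ tabulate c ∣ ≡ ∑[ i < n ] (⟦ b i ⟧ * ⟦ c i ⟧)
∣tabulate-∩∣ {zero}  b c = refl
∣tabulate-∩∣ {suc n} b c with b zero | c zero
... | true  | true  = cong suc (∣tabulate-∩∣ (b ∘ suc) (c ∘ suc))
... | true  | false = ∣tabulate-∩∣ (b ∘ suc) (c ∘ suc)
... | false | _     = ∣tabulate-∩∣ (b ∘ suc) (c ∘ suc)

δ : ∀ {n} → Fin n → Fin n → ℕ
δ x y = ⟦ does (x ≟ y) ⟧

δ-≢ : ∀ {n} {x y : Fin n} → x ≢ y → δ x y ≡ 0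
δ-≢ {x = x} {y} x≢y = cong ⟦_⟧ (dec-false (x ≟ y) x≢y)

sum-δ : ∀ {n} (z : Fin n) (h : Fin n → ℕ) → ∑[ x < n ] (δ z x * h x) ≡ h z
sum-δ {suc n} zero h = begin
  h zero + 0 + ∑[ x < n ] 0  ≡⟨ cong (h zero + 0 +_) (sum-replicate-zero n) ⟩
  h zero + 0 + 0             ≡⟨ +-identityʳ _ ⟩
  h zero + 0                 ≡⟨ +-identityʳ _ ⟩
  h zero                     ∎
  where open ≡-Reasoning
sum-δ (suc z) h = sum-δ z (h ∘ suc)

sum-δ-1 : ∀ {n} (z : Fin n) → ∑[ x < n ] δ z x ≡ 1
sum-δ-1 z = trans (sum-cong-≗ (λ x → sym (*-identityʳ (δ z x)))) (sum-δ z (λ _ → 1))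

sum≡0 : ∀ {n} (h : Fin n → ℕ) → sum h ≡ 0 → ∀ x → h x ≡ 0
sum≡0 h eq zero    = m+n≡0⇒m≡0 (h zero) eq
sum≡0 h eq (suc x) = sum≡0 (h ∘ suc) (m+n≡0⇒n≡0 (h zero) eq) x

exists-true : ∀ {n j} (b : Fin n → Bool) → ∑[ x < n ] ⟦ b x ⟧ ≡ suc j →
  ∃[ x ] b x ≡ true
exists-true {suc n} b eq with b zero in b0
... | true  = zero , b0
... | false = let (x , bx) = exists-true (b ∘ suc) eq in suc x , bx

unique-true : ∀ {n} (b : Fin n → Bool) → ∑[ x < n ] ⟦ b x ⟧ ≡ 1 →
  ∃[ x ] (b x ≡ true × ∀ y → b y ≡ true → y ≡ x)
unique-true {suc n} b eq with b zero in b0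
... | true  = zero , b0 , only
  where
  only : ∀ y → b y ≡ true → y ≡ zero
  only zero    _  = refl
  only (suc y) by with () ←
    trans (sym (cong ⟦_⟧ by)) (sum≡0 (⟦_⟧ ∘ b ∘ suc) (suc-injective eq) y)
... | false = let (x , bx , only) = unique-true (b ∘ suc) eq in
  suc x , bx , λ where
    zero    by → contradiction (trans (sym by) b0) λ ()
    (suc y) by → cong suc (only y by)

-- Provides a neighbour of a vertex that is not its mate.
exists-other : ∀ {n j} (b : Fin n → Bool) (z : Fin n) →
  ∑[ x < n ] ⟦ b x ⟧ ≡ suc (suc j) → ∃[ x ] (x ≢ z × b x ≡ true)
exists-other {suc n} b z eq with b zero in b0
exists-other {suc n} b zero    eq | true  =
  let (x , bx) = exists-true (b ∘ suc) (suc-injective eq) in suc x , (λ ()) , bx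
exists-other {suc n} b (suc z) eq | true  = zero , (λ ()) , b0
exists-other {suc n} b zero    eq | false =
  let (x , bx) = exists-true (b ∘ suc) eq in suc x , (λ ()) , bx
exists-other {suc n} b (suc z) eq | false =
  let (x , x≢z , bx) = exists-other (b ∘ suc) z eq in
  suc x , x≢z ∘ Fin.suc-injective , bx

<?-swap : ∀ {p q} → p ≢ q → does (q <? p) ≡ not (does (p <? q))
<?-swap {p} {q} p≢q = does-⇔
  (mk⇔ <-asym (λ p≮q → ≤∧≢⇒< (≮⇒≥ p≮q) (p≢q ∘ sym))) (q <? p) (¬? (p <? q))

-- Turns the subset cut out by `c` into some `Fin size`, so that a graph on representatives of the
-- pairs of mates has a vertex set of the required form.
record Enumeration {n} (c : Fin n → Bool) : Set where
  field
    size      : ℕ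
    elem      : Fin size → Fin n
    elem-true : ∀ i → c (elem i) ≡ true
    injective : ∀ {i j} → elem i ≡ elem j → i ≡ j
    index     : ∀ x → c x ≡ true → ∃[ i ] elem i ≡ x
    sum-elem  : ∀ (h : Fin n → ℕ) →
      ∑[ x < n ] (⟦ c x ⟧ * h x) ≡ ∑[ i < size ] h (elem i)

enumerate : ∀ {n} (c : Fin n → Bool) → Enumeration c
enumerate {zero} c = record
  { size = 0 ; elem = λ () ; elem-true = λ () ; injective = λ { {()} }
  ; index = λ () ; sum-elem = λ _ → refl }
enumerate {suc n} c with c zero in c0 | enumerate (c ∘ suc)
... | false | E = record
  { size      = size
  ; elem      = suc ∘ elem
  ; elem-true = elem-true
  ; injective = injective ∘ Fin.suc-injective
  ; index     = λ where
      zero    cx → contradiction (trans (sym cx) c0) λ ()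
      (suc x) cx → map₂ (cong suc) (index x cx)
  ; sum-elem  = λ h → trans
      (cong (λ b → ⟦ b ⟧ * h zero + ∑[ x < n ] (⟦ c (suc x) ⟧ * h (suc x))) c0)
      (sum-elem (h ∘ suc))
  }
  where open Enumeration E
... | true  | E = record
  { size      = suc size
  ; elem      = elem′
  ; elem-true = λ { zero → c0 ; (suc i) → elem-true i }
  ; injective = injective′
  ; index     = λ where
      zero    cx → zero , refl
      (suc x) cx → let (i , eq) = index x cx in suc i , cong suc eq
  ; sum-elem  = λ h → cong₂ _+_
      (trans (cong (λ b → ⟦ b ⟧ * h zero) c0) (*-identityˡ (h zero)))
      (sum-elem (h ∘ suc))
  }
  where
  open Enumeration E
  elem′ : Fin (suc size) → Fin (suc n)
  elem′ zero    = zero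
  elem′ (suc i) = suc (elem i)
  injective′ : ∀ {i j} → elem′ i ≡ elem′ j → i ≡ j
  injective′ {zero}  {zero}  _  = refl
  injective′ {suc i} {suc j} eq = cong suc (injective (Fin.suc-injective eq))

≅⇒construction₂ : ∀ {V m} {Γ : Graph V} {Δ : Graph (Fin m)} {σ} → IsBase Δ →
  (s : IsSwitchingInvolution Δ σ) → Γ ≅ construction₂ Δ s → FromConstruction₂ Γ
≅⇒construction₂ {m = m} {Δ = Δ} {σ} base s iso = m , Δ , base , σ , s , iso

-- The degree is written `suc (a + suc d)`, so that `k - 1 = a + suc d` exceeds `a` by construction.
-- The sums are the entries of the square of the adjacency matrix.
module MatchedGraph {n} (Γ : Graph (Fin n)) (a d : ℕ)
  (degree : ∀ v → ∑[ x < n ] ⟦ adj Γ v x ⟧ ≡ suc (a + suc d))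
  (mate : Fin n → Fin n)
  (mate-≢ : ∀ v → mate v ≢ v)
  (common-mate : ∀ v →
    ∑[ x < n ] (⟦ adj Γ (mate v) x ⟧ * ⟦ adj Γ v x ⟧) ≡ a + suc d)
  (common-other : ∀ v w → w ≢ v → w ≢ mate v →
    ∑[ x < n ] (⟦ adj Γ w x ⟧ * ⟦ adj Γ v x ⟧) ≡ a)
  where

  open ≡-Reasoning

  -- The square and cube of the adjacency matrix; mates form an automorphism.

  A : Fin n → Fin n → Bool
  A = adj Γ

  α : Fin n → Fin n → ℕ
  α u v = ⟦ A u v ⟧

  α-sym : ∀ u v → α u v ≡ α v u
  α-sym u v = cong ⟦_⟧ (symmetric Γ u v)

  cn : Fin n → Fin n → ℕ
  cn u v = ∑[ x < n ] (α u x * α v x)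

  cn-sym : ∀ u v → cn u v ≡ cn v u
  cn-sym u v = sum-cong-≗ λ x → *-comm (α u x) (α v x)

  cn-refl : ∀ v → cn v v ≡ suc (a + suc d)
  cn-refl v = trans (sum-cong-≗ λ x → ⟦⟧-idem (A v x)) (degree v)

  -- Otherwise `v` would be an ordinary vertex for `mate v`, and the two would share only `a`
  -- neighbours.
  mate-involutive : ∀ v → mate (mate v) ≡ v
  mate-involutive v with v ≟ mate (mate v)
  ... | yes eq = sym eq
  ... | no neq = contradiction
    (begin
      a           ≡⟨ common-other (mate v) v (mate-≢ v ∘ sym) neq ⟨
      cn v (mate v) ≡⟨ cn-sym v (mate v) ⟩
      cn (mate v) v ≡⟨ common-mate v ⟩
      a + suc d   ≡⟨ +-suc a d ⟩
      suc (a + d) ∎)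
    (m≢1+m+n a)

  mate-injective : ∀ {u v} → mate u ≡ mate v → u ≡ v
  mate-injective {u} {v} eq =
    trans (sym (mate-involutive u)) (trans (cong mate eq) (mate-involutive v))

  -- The coefficients `2 + d` and `suc d` are the excesses over `a` of the degree and of the number
  -- of common neighbours of two mates.
  cn-formula : ∀ x w →
    cn x w ≡ a + δ w x * (2 + d) + δ (mate w) x * suc d
  cn-formula x w with w ≟ x
  ... | yes refl rewrite δ-≢ (mate-≢ w) = trans (cn-refl w) (lemma a d)
    where
    lemma : ∀ a d → suc (a + suc d) ≡ a + (1 * (2 + d)) + 0
    lemma = solve-∀
  ... | no w≢x with mate w ≟ x
  ...   | yes refl = trans (common-mate w) (lemma a d)
    where
    lemma : ∀ a d → a + suc d ≡ a + 0 + 1 * suc d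
    lemma = solve-∀
  ...   | no w′≢x = trans (common-other w x (w≢x ∘ sym) (w′≢x ∘ sym)) (lemma a)
    where
    lemma : ∀ a → a ≡ a + 0 + 0
    lemma = solve-∀

  -- The entries of A³.
  cubic : Fin n → Fin n → ℕ
  cubic u w = ∑[ x < n ] (α u x * cn x w)

  -- Multiply `cn-formula` by `A` on the left: the all-ones part contributes `a` times the degree,
  -- and each `δ` selects one entry of row `u`.
  cubic-formula : ∀ u w → cubic u w ≡
    a * suc (a + suc d) + (2 + d) * α u w + suc d * α u (mate w)
  cubic-formula u w = begin
    ∑[ x < n ] (α u x * cn x w)
      ≡⟨ sum-cong-≗ (λ x → trans (cong (α u x *_) (cn-formula x w))
          (expand (α u x) a (δ w x) (2 + d) (δ (mate w) x) (suc d))) ⟩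
    ∑[ x < n ] (a * α u x + (2 + d) * (δ w x * α u x)
                + suc d * (δ (mate w) x * α u x))
      ≡⟨ ∑-distrib-+ (λ x → a * α u x + (2 + d) * (δ w x * α u x))
           (λ x → suc d * (δ (mate w) x * α u x)) ⟩
    ∑[ x < n ] (a * α u x + (2 + d) * (δ w x * α u x))
    + ∑[ x < n ] (suc d * (δ (mate w) x * α u x))
      ≡⟨ cong (_+ ∑[ x < n ] (suc d * (δ (mate w) x * α u x)))
           (∑-distrib-+ (λ x → a * α u x)
           (λ x → (2 + d) * (δ w x * α u x))) ⟩
    ∑[ x < n ] (a * α u x) + ∑[ x < n ] ((2 + d) * (δ w x * α u x))
    + ∑[ x < n ] (suc d * (δ (mate w) x * α u x))
      ≡⟨ cong₂ _+_ (cong₂ _+_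
           (trans (sym (*-distribˡ-sum a (α u))) (cong (a *_) (degree u)))
           (weighted (2 + d) w)) (weighted (suc d) (mate w)) ⟩
    a * suc (a + suc d) + (2 + d) * α u w + suc d * α u (mate w) ∎
    where
    expand : ∀ s a p b q c →
      s * (a + p * b + q * c) ≡ a * s + b * (p * s) + c * (q * s)
    expand = solve-∀
    weighted : ∀ c z → ∑[ x < n ] (c * (δ z x * α u x)) ≡ c * α u z
    weighted c z = trans (sym (*-distribˡ-sum c (λ x → δ z x * α u x)))
      (cong (c *_) (sum-δ z (α u)))

  cubic-sym : ∀ u w → cubic u w ≡ cubic w u
  cubic-sym u w = begin
    ∑[ x < n ] (α u x * ∑[ y < n ] (α x y * α w y))
      ≡⟨ sum-cong-≗ (λ x → *-distribˡ-sum (α u x) (λ y → α x y * α w y)) ⟩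
    ∑[ x < n ] ∑[ y < n ] (α u x * (α x y * α w y))
      ≡⟨ ∑-comm (λ x y → α u x * (α x y * α w y)) ⟩
    ∑[ y < n ] ∑[ x < n ] (α u x * (α x y * α w y))
      ≡⟨ sum-cong-≗ (λ y → sum-cong-≗ (λ x →
           trans (cong (λ z → α u x * (z * α w y)) (α-sym x y))
                 (rotate (α u x) (α y x) (α w y)))) ⟩
    ∑[ y < n ] ∑[ x < n ] (α w y * (α y x * α u x))
      ≡⟨ sum-cong-≗ (λ y → *-distribˡ-sum (α w y) (λ x → α y x * α u x)) ⟨
    ∑[ y < n ] (α w y * ∑[ x < n ] (α y x * α u x)) ∎
    where
    rotate : ∀ p q r → p * (q * r) ≡ r * (q * p)
    rotate = solve-∀

  -- In the symmetric cube all terms but the last are visibly symmetric, so the last one is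
  -- symmetric too.
  mate-symmetric : ∀ u w → A u (mate w) ≡ A (mate u) w
  -- The coefficient `suc d` can be cancelled because it is nonzero, that is, because `a` is less
  -- than `k - 1`.
  mate-symmetric u w = trans (⟦⟧-injective (*-cancelˡ-≡ _ _ (suc d)
    (+-cancelˡ-≡ (a * suc (a + suc d) + (2 + d) * α u w) _ _ (begin
      a * suc (a + suc d) + (2 + d) * α u w + suc d * α u (mate w)
        ≡⟨ cubic-formula u w ⟨
      cubic u w ≡⟨ cubic-sym u w ⟩
      cubic w u ≡⟨ cubic-formula w u ⟩
      a * suc (a + suc d) + (2 + d) * α w u + suc d * α w (mate u)
        ≡⟨ cong (λ z → a * suc (a + suc d) + (2 + d) * z + suc d * α w (mate u))
             (α-sym w u) ⟩
      a * suc (a + suc d) + (2 + d) * α u w + suc d * α w (mate u) ∎))))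
    (symmetric Γ w (mate u))

  mate-automorphism : ∀ u w → A (mate u) (mate w) ≡ A u w
  mate-automorphism u w =
    trans (mate-symmetric (mate u) w) (cong (λ z → A z w) (mate-involutive u))

  -- Private neighbours and the involutions `f` and `g`.

  abstract
    -- Of the `suc (a + suc d)` neighbours of `v`, exactly `a + suc d` are shared with `mate v`,
    -- which leaves one.
    private-neighbour : ∀ v →
      ∃[ x ] (A v x ∧ not (A (mate v) x) ≡ true ×
              ∀ y → A v y ∧ not (A (mate v) y) ≡ true → y ≡ x)
    private-neighbour v = unique-true _ (+-cancelʳ-≡ (a + suc d) _ 1 (begin
      ∑[ x < n ] ⟦ A v x ∧ not (A (mate v) x) ⟧ + (a + suc d)
        ≡⟨ cong (∑[ x < n ] ⟦ A v x ∧ not (A (mate v) x) ⟧ +_) (common-mate v) ⟨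
      ∑[ x < n ] ⟦ A v x ∧ not (A (mate v) x) ⟧ + cn (mate v) v
        ≡⟨ ∑-distrib-+ (λ x → ⟦ A v x ∧ not (A (mate v) x) ⟧) _ ⟨
      ∑[ x < n ] (⟦ A v x ∧ not (A (mate v) x) ⟧ + α (mate v) x * α v x)
        ≡⟨ sum-cong-≗ (λ x → split (A v x) (A (mate v) x)) ⟩
      ∑[ x < n ] α v x
        ≡⟨ degree v ⟩
      suc (a + suc d) ∎))
      where
      split : ∀ b c → ⟦ b ∧ not c ⟧ + ⟦ c ⟧ * ⟦ b ⟧ ≡ ⟦ b ⟧
      split true  true  = refl
      split true  false = refl
      split false true  = refl
      split false false = refl

  f : Fin n → Fin n
  f v = proj₁ (private-neighbour v)

  ∧-not⁻ : ∀ {b c} → b ∧ not c ≡ true → b ≡ true × c ≡ false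
  ∧-not⁻ {true} {false} _ = refl , refl

  f-adjacent : ∀ v → A v (f v) ≡ true
  f-adjacent v = proj₁ (∧-not⁻ (proj₁ (proj₂ (private-neighbour v))))

  f-private : ∀ v → A (mate v) (f v) ≡ false
  f-private v = proj₂ (∧-not⁻ {A v (f v)} (proj₁ (proj₂ (private-neighbour v))))

  f-unique : ∀ v {y} → A v y ≡ true → A (mate v) y ≡ false → f v ≡ y
  f-unique v {y} p q = sym (proj₂ (proj₂ (private-neighbour v)) y
    (cong₂ (λ b c → b ∧ not c) p q))

  -- Being private is mutual: by `mate-symmetric`, `v` is not adjacent to `mate (f v)`, since
  -- `mate v` is not adjacent to `f v`.
  f-involutive : ∀ v → f (f v) ≡ v
  f-involutive v = f-unique (f v)
    (trans (symmetric Γ (f v) v) (f-adjacent v))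
    (trans (symmetric Γ (mate (f v)) v)
      (trans (mate-symmetric v (f v)) (f-private v)))

  f-mate : ∀ v → f (mate v) ≡ mate (f v)
  f-mate v = f-unique (mate v)
    (trans (mate-automorphism v (f v)) (f-adjacent v))
    (trans (mate-automorphism (mate v) (f v)) (f-private v))

  -- A vertex that distinguishes `v` from `mate v` is private to one of them, hence `f v` or
  -- `f (mate v)`.
  twins : ∀ {v y} → y ≢ f v → y ≢ mate (f v) → A (mate v) y ≡ A v y
  twins {v} {y} y≢fv y≢f′v with A v y in p | A (mate v) y in q
  ... | true  | true  = refl
  ... | false | false = refl
  ... | true  | false = contradiction (sym (f-unique v p q)) y≢fv
  ... | false | true  = contradiction
    (trans (sym (f-unique (mate v) q
        (trans (cong (λ z → A z y) (mate-involutive v)) p)))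
      (f-mate v)) y≢f′v

  f-≢ : ∀ v → f v ≢ v
  f-≢ v eq with () ←
    trans (sym (f-adjacent v)) (trans (cong (A v) eq) (irreflexive Γ v))

  f-injective : ∀ {u v} → f u ≡ f v → u ≡ v
  f-injective {u} {v} eq =
    trans (sym (f-involutive u)) (trans (cong f eq) (f-involutive v))

  -- As the private neighbour of `mate v`, `g v` is not adjacent to `v`. This makes `g`, unlike `f`,
  -- suitable for dual Seidel switching.
  g : Fin n → Fin n
  g = f ∘ mate

  g-mate : ∀ v → g (mate v) ≡ mate (g v)
  g-mate v = f-mate (mate v)

  g-involutive : ∀ v → g (g v) ≡ v
  g-involutive v = begin
    f (mate (f (mate v))) ≡⟨ cong f (f-mate (mate v)) ⟨
    f (f (mate (mate v))) ≡⟨ f-involutive (mate (mate v)) ⟩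
    mate (mate v)         ≡⟨ mate-involutive v ⟩
    v                     ∎

  g-injective : ∀ {u v} → g u ≡ g v → u ≡ v
  g-injective {u} {v} eq =
    trans (sym (g-involutive u)) (trans (cong g eq) (g-involutive v))

  -- Representatives of the pairs of mates.

  -- Comparing ranks chooses one vertex of every pair {v , mate v} in such a
  -- way that g maps chosen vertices to chosen vertices.
  rank : Fin n → ℕ
  rank v = toℕ v ⊓ toℕ (g v)

  rank-g : ∀ v → rank (g v) ≡ rank v
  rank-g v = trans (cong (λ x → toℕ (g v) ⊓ toℕ x) (g-involutive v))
                   (⊓-comm (toℕ (g v)) (toℕ v))

  -- Each rank is attained at a vertex or at its image under `g`. In all four combinations equality
  -- would give `mate` or `f` a fixed point.
  rank-mate : ∀ v → rank v ≢ rank (mate v)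
  rank-mate v eq
    with ⊓-sel (toℕ v) (toℕ (g v)) | ⊓-sel (toℕ (mate v)) (toℕ (g (mate v)))
  ... | inj₁ p | inj₁ q =
    mate-≢ v (sym (toℕ-injective (trans (sym p) (trans eq q))))
  ... | inj₁ p | inj₂ q =
    f-≢ v (trans (cong f (sym (mate-involutive v)))
      (sym (toℕ-injective (trans (sym p) (trans eq q)))))
  ... | inj₂ p | inj₁ q = f-≢ (mate v) (toℕ-injective (trans (sym p) (trans eq q)))
  ... | inj₂ p | inj₂ q =
    mate-≢ v (sym (g-injective (toℕ-injective (trans (sym p) (trans eq q)))))

  chosen : Fin n → Bool
  chosen v = does (rank v <? rank (mate v))

  chosen-mate : ∀ v → chosen (mate v) ≡ not (chosen v)
  chosen-mate v = trans
    (cong (λ x → does (rank (mate v) <? rank x)) (mate-involutive v))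
    (<?-swap (rank-mate v))

  chosen-g : ∀ v → chosen (g v) ≡ chosen v
  chosen-g v = cong₂ (λ p q → does (p <? q)) (rank-g v)
    (trans (cong rank (sym (g-mate v))) (rank-g (mate v)))

  open Enumeration (enumerate chosen) public
    renaming (size to m; elem to e; elem-true to e-chosen;
              injective to e-injective; sum-elem to sum-chosen)

  -- Split into chosen and unchosen vertices and reindex the latter by `mate`, which exchanges the
  -- two kinds.
  sum-pairs : ∀ h → sum h ≡ ∑[ i < m ] (h (e i) + h (mate (e i)))
  sum-pairs h = begin
    sum h
      ≡⟨ sum-cong-≗ (λ x → split (chosen x) (h x)) ⟩
    ∑[ x < n ] (⟦ chosen x ⟧ * h x + ⟦ not (chosen x) ⟧ * h x)
      ≡⟨ ∑-distrib-+ (λ x → ⟦ chosen x ⟧ * h x) _ ⟩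
    ∑[ x < n ] (⟦ chosen x ⟧ * h x) + ∑[ x < n ] (⟦ not (chosen x) ⟧ * h x)
      ≡⟨ cong (∑[ x < n ] (⟦ chosen x ⟧ * h x) +_)
           (∑-permute (λ x → ⟦ not (chosen x) ⟧ * h x)
             (permutation mate mate mate-involutive mate-involutive)) ⟩
    ∑[ x < n ] (⟦ chosen x ⟧ * h x)
    + ∑[ x < n ] (⟦ not (chosen (mate x)) ⟧ * h (mate x))
      ≡⟨ cong (∑[ x < n ] (⟦ chosen x ⟧ * h x) +_)
           (sum-cong-≗ (λ x → cong (λ b → ⟦ b ⟧ * h (mate x))
           (trans (cong not (chosen-mate x)) (not-involutive (chosen x))))) ⟩
    ∑[ x < n ] (⟦ chosen x ⟧ * h x) + ∑[ x < n ] (⟦ chosen x ⟧ * h (mate x))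
      ≡⟨ cong₂ _+_ (sum-chosen h) (sum-chosen (h ∘ mate)) ⟩
    ∑[ i < m ] h (e i) + ∑[ i < m ] h (mate (e i))
      ≡⟨ ∑-distrib-+ (h ∘ e) (h ∘ mate ∘ e) ⟨
    ∑[ i < m ] (h (e i) + h (mate (e i))) ∎
    where
    split : ∀ b x → x ≡ ⟦ b ⟧ * x + ⟦ not b ⟧ * x
    split true  = solve-∀
    split false = solve-∀

  -- Parity of `a`, and the automorphisms `f` and `g`.

  γ : Fin n → Fin n → ℕ
  γ v x = α v x * α (mate v) x

  γ-f : ∀ v → γ v (f v) ≡ 0
  γ-f v = trans (cong (λ b → α v (f v) * ⟦ b ⟧) (f-private v)) (*-zeroʳ (α v (f v)))

  γ-other : ∀ {v x} → f v ≢ x → γ v x ≡ α v x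
  γ-other {v} {x} fv≢x with A v x in p | A (mate v) x in q
  ... | true  | true  = refl
  ... | true  | false = contradiction (f-unique v p q) fv≢x
  ... | false | _     = refl

  -- `γ v` marks the common neighbours of `v` and `mate v`; passing from `x` to `mate x` swaps its
  -- two factors.
  γ-mate : ∀ v x → γ v (mate x) ≡ γ v x
  γ-mate v x = trans (cong₂ (λ b c → ⟦ b ⟧ * ⟦ c ⟧)
    (mate-symmetric v x) (mate-automorphism v x)) (*-comm (α (mate v) x) (α v x))

  half : Fin n → Fin n → ℕ
  half v w = ∑[ i < m ] (γ v (e i) * γ w (e i))

  sum-γγ : ∀ v w → ∑[ x < n ] (γ v x * γ w x) ≡ 2 * half v w
  sum-γγ v w = begin
    ∑[ x < n ] (γ v x * γ w x)
      ≡⟨ sum-pairs (λ x → γ v x * γ w x) ⟩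
    ∑[ i < m ] (γ v (e i) * γ w (e i) + γ v (mate (e i)) * γ w (mate (e i)))
      ≡⟨ sum-cong-≗ (λ i → trans
           (cong (γ v (e i) * γ w (e i) +_)
             (cong₂ _*_ (γ-mate v (e i)) (γ-mate w (e i))))
           (double (γ v (e i) * γ w (e i)))) ⟩
    ∑[ i < m ] (2 * (γ v (e i) * γ w (e i)))
      ≡⟨ *-distribˡ-sum 2 (λ i → γ v (e i) * γ w (e i)) ⟨
    2 * half v w ∎
    where
    double : ∀ x → x + x ≡ 2 * x
    double = solve-∀

  -- The neighbours of `v` are `f v` and the vertices marked by `γ v`, and likewise for `w`. As
  -- `f v` and `f w` differ, the common neighbours split into `f v` if adjacent to `w`, `f w` if
  -- adjacent to `v`, and those marked by both, which come in pairs of mates.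
  a-parity : ∀ {v w} → w ≢ v → w ≢ mate v →
    a ≡ α w (f v) + α v (f w) + 2 * half v w
  a-parity {v} {w} w≢v w≢v′ = begin
    a        ≡⟨ common-other v w w≢v w≢v′ ⟨
    cn w v   ≡⟨ sum-cong-≗ pointwise ⟩
    ∑[ x < n ] (δ (f v) x * α w x + δ (f w) x * α v x + γ v x * γ w x)
      ≡⟨ ∑-distrib-+ (λ x → δ (f v) x * α w x + δ (f w) x * α v x) _ ⟩
    ∑[ x < n ] (δ (f v) x * α w x + δ (f w) x * α v x)
    + ∑[ x < n ] (γ v x * γ w x)
      ≡⟨ cong₂ _+_ (∑-distrib-+ (λ x → δ (f v) x * α w x) _) (sum-γγ v w) ⟩
    ∑[ x < n ] (δ (f v) x * α w x) + ∑[ x < n ] (δ (f w) x * α v x) + 2 * half v w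
      ≡⟨ cong (_+ 2 * half v w) (cong₂ _+_ (sum-δ (f v) (α w)) (sum-δ (f w) (α v))) ⟩
    α w (f v) + α v (f w) + 2 * half v w ∎
    where
    pointwise : ∀ x → α w x * α v x ≡
      δ (f v) x * α w x + δ (f w) x * α v x + γ v x * γ w x
    pointwise x with f v ≟ x
    ... | yes refl rewrite γ-f v | f-adjacent v
                         | δ-≢ (w≢v ∘ f-injective) = ring₁ (α w (f v))
      where
      ring₁ : ∀ p → p * 1 ≡ 1 * p + 0 + 0
      ring₁ = solve-∀
    ... | no fv≢x with f w ≟ x
    ...   | yes refl rewrite γ-f w | f-adjacent w = ring₂ (α v (f w)) (γ v (f w))
      where
      ring₂ : ∀ p q → 1 * p ≡ 0 + 1 * p + q * 0
      ring₂ = solve-∀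
    ...   | no fw≢x rewrite γ-other fv≢x | γ-other fw≢x = *-comm (α w x) (α v x)

  -- For `w = f v` both bits in `a-parity` are diagonal entries of `A`, since `f (f v) = v`.
  moved⇒a-even : ∀ {v} → f v ≢ mate v → ∃[ t ] a ≡ 2 * t
  moved⇒a-even {v} fv≢v′ = half v (f v) , trans (a-parity (f-≢ v) fv≢v′)
    (cong (_+ 2 * half v (f v)) (cong₂ (λ b c → ⟦ b ⟧ + ⟦ c ⟧)
      (irreflexive Γ (f v))
      (trans (cong (A v) (f-involutive v)) (irreflexive Γ v))))

  a-even : Fin n → ∃[ t ] a ≡ 2 * t
  a-even v with f v ≟ mate v
  ... | no fv≢v′ = moved⇒a-even fv≢v′
  ... | yes fv≡v′
    -- The degree is `2 + (a + d)`, so some neighbour `w` of `v` is not `mate v`.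
    with exists-other (A v) (mate v) (trans (degree v) (cong suc (+-suc a d)))
  ...   | w , w≢v′ , vw with f w ≟ mate w
  ...     | no fw≢w′ = moved⇒a-even fw≢w′
  -- Here `f` agrees with `mate` at `v` and `w`, so both bits in `a-parity` equal `α w (mate v)` by
  -- `mate-symmetric`.
  ...     | yes fw≡w′ = α w (mate v) + half v w , (begin
    a ≡⟨ a-parity
           (λ { refl → contradiction (trans (sym vw) (irreflexive Γ v)) λ () }) w≢v′ ⟩
    α w (f v) + α v (f w) + 2 * half v w
      ≡⟨ cong₂ (λ p q → p + q + 2 * half v w) (cong (α w) fv≡v′)
           (trans (cong (α v) fw≡w′) (cong ⟦_⟧
             (trans (mate-symmetric v w) (symmetric Γ (mate v) w)))) ⟩
    α w (mate v) + α w (mate v) + 2 * half v w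
      ≡⟨ double (α w (mate v)) (half v w) ⟩
    2 * (α w (mate v) + half v w) ∎)
    where
    double : ∀ p q → p + p + 2 * q ≡ 2 * (p + q)
    double = solve-∀

  -- As `a` is even, the two bits in `a-parity` have an even sum and therefore agree.
  f-swap : ∀ {v w} → w ≢ v → w ≢ mate v → A w (f v) ≡ A v (f w)
  f-swap {v} {w} w≢v w≢v′ with a-even v
  ... | t , a≡2t = equal-bits (A w (f v)) (A v (f w)) (half v w) t
    (trans (sym (a-parity w≢v w≢v′)) a≡2t)
    where
    equal-bits : ∀ b c s t → ⟦ b ⟧ + ⟦ c ⟧ + 2 * s ≡ 2 * t → b ≡ c
    equal-bits true  true  _ _ _  = refl
    equal-bits false false _ _ _  = refl
    equal-bits true  false s t eq = contradiction (sym eq) (even≢odd t s)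
    equal-bits false true  s t eq = contradiction (sym eq) (even≢odd t s)

  -- Apply `f-swap` to `v` and `f w`. Its excluded cases `f w = v` and `f w = mate v` follow
  -- directly, the latter because `f` commutes with `mate`.
  f-automorphism : ∀ v w → A (f v) (f w) ≡ A v w
  f-automorphism v w with f w ≟ v | f w ≟ mate v
  ... | yes refl | _ = trans (cong (λ x → A x (f w)) (f-involutive w))
                             (symmetric Γ w (f w))
  ... | no _ | yes fw≡v′ = begin
    A (f v) (f w)        ≡⟨ cong (A (f v)) fw≡v′ ⟩
    A (f v) (mate v)     ≡⟨ mate-symmetric (f v) v ⟩
    A (mate (f v)) v     ≡⟨ cong (λ x → A x v) (f-mate v) ⟨
    A (f (mate v)) v     ≡⟨ cong (λ x → A (f x) v) fw≡v′ ⟨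
    A (f (f w)) v        ≡⟨ cong (λ x → A x v) (f-involutive w) ⟩
    A w v                ≡⟨ symmetric Γ w v ⟩
    A v w                ∎
  ... | no fw≢v | no fw≢v′ = begin
    A (f v) (f w)  ≡⟨ symmetric Γ (f v) (f w) ⟩
    A (f w) (f v)  ≡⟨ f-swap fw≢v fw≢v′ ⟩
    A v (f (f w))  ≡⟨ cong (A v) (f-involutive w) ⟩
    A v w          ∎

  g-automorphism : ∀ u v → A (g u) (g v) ≡ A u v
  g-automorphism u v =
    trans (f-automorphism (mate u) (mate v)) (mate-automorphism u v)

  -- The switched graph.

  -- The dual Seidel switching of Γ, in which mates become adjacent twins.
  A₁ : Fin n → Fin n → Bool
  A₁ u v = A (g u) v

  A₁-symmetric : ∀ u v → A₁ u v ≡ A₁ v u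
  A₁-symmetric u v = begin
    A (g u) v         ≡⟨ g-automorphism (g u) v ⟨
    A (g (g u)) (g v) ≡⟨ cong (λ x → A x (g v)) (g-involutive u) ⟩
    A u (g v)         ≡⟨ symmetric Γ u (g v) ⟩
    A (g v) u         ∎

  A₁-irreflexive : ∀ v → A₁ v v ≡ false
  A₁-irreflexive v = trans (symmetric Γ (g v) v)
    (trans (cong (λ x → A x (g v)) (sym (mate-involutive v))) (f-private (mate v)))

  A₁-mates : ∀ v → A₁ v (mate v) ≡ true
  A₁-mates v = trans (symmetric Γ (g v) (mate v)) (f-adjacent (mate v))

  A₁-mate : ∀ u v → A₁ (mate u) (mate v) ≡ A₁ u v
  A₁-mate u v = trans (cong (λ x → A x (mate v)) (g-mate u))
                      (mate-automorphism (g u) v)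

  -- By `twins`, the rows of `g u` and `mate (g u)` in `A` differ at most at `f (g u) = mate u` and
  -- at its mate `u`.
  A₁-twins : ∀ {u v} → v ≢ u → v ≢ mate u → A₁ (mate u) v ≡ A₁ u v
  A₁-twins {u} {v} v≢u v≢u′ = trans (cong (λ x → A x v) (g-mate u))
    (twins (λ eq → v≢u′ (trans eq fgu))
           (λ eq → v≢u (trans eq (trans (cong mate fgu) (mate-involutive u)))))
    where
    fgu : f (g u) ≡ mate u
    fgu = f-involutive (mate u)

  g-A₁ : ∀ u v → A₁ (g u) v ≡ A u v
  g-A₁ u v = cong (λ x → A x v) (g-involutive u)

  -- The graph `Δ` on the pairs of mates and its parameters.

  Δ : Graph (Fin m)
  Δ = record
    { adj         = λ i j → A₁ (e i) (e j)
    ; symmetric   = λ i j → A₁-symmetric (e i) (e j)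
    ; irreflexive = λ i → A₁-irreflexive (e i)
    }

  e-≢-mate : ∀ i j → e i ≢ mate (e j)
  e-≢-mate i j eq with () ← trans (sym (e-chosen i))
    (trans (cong chosen eq) (trans (chosen-mate (e j)) (cong not (e-chosen j))))

  -- Shows that adjacency of distinct pairs does not depend on the representatives.
  Δ-twins : ∀ {i j} → i ≢ j → A₁ (mate (e i)) (e j) ≡ adj Δ i j
  Δ-twins {i} {j} i≢j = A₁-twins (i≢j ∘ sym ∘ e-injective) (e-≢-mate j i)

  Δ-twinsʳ : ∀ {i j} → i ≢ j → A₁ (e i) (mate (e j)) ≡ adj Δ i j
  Δ-twinsʳ {i} {j} i≢j = begin
    A₁ (e i) (mate (e j)) ≡⟨ A₁-symmetric (e i) (mate (e j)) ⟩
    A₁ (mate (e j)) (e i) ≡⟨ Δ-twins (i≢j ∘ sym) ⟩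
    A₁ (e j) (e i)        ≡⟨ A₁-symmetric (e j) (e i) ⟩
    A₁ (e i) (e j)        ∎

  b : Fin m → Fin m → ℕ
  b i j = ⟦ adj Δ i j ⟧

  degΔ : Fin m → ℕ
  degΔ i = ∑[ j < m ] b i j

  cnΔ : Fin m → Fin m → ℕ
  cnΔ i j = ∑[ z < m ] (b i z * b j z)

  -- With `B` the matrix of `Δ`, the block of `A₁` between chosen vertices and mates is `B + I`,
  -- whereas the block within the chosen vertices is `B`.
  α₁-mate : ∀ i j → ⟦ A₁ (e i) (mate (e j)) ⟧ ≡ b i j + δ i j
  α₁-mate i j with i ≟ j
  ... | yes refl = trans (cong ⟦_⟧ (A₁-mates (e i)))
    (cong (λ c → ⟦ c ⟧ + 1) (sym (A₁-irreflexive (e i))))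
  ... | no i≢j = trans (cong ⟦_⟧ (Δ-twinsʳ i≢j)) (sym (+-identityʳ _))

  -- Row `e i` of `A₁` is row `g (e i)` of `A`; its two blocks contribute row `i` of `B` and of
  -- `B + I`.
  double-degree : ∀ i → suc (a + suc d) ≡ suc (2 * degΔ i)
  double-degree i = begin
    suc (a + suc d) ≡⟨ degree (g (e i)) ⟨
    ∑[ x < n ] ⟦ A₁ (e i) x ⟧ ≡⟨ sum-pairs (λ x → ⟦ A₁ (e i) x ⟧) ⟩
    ∑[ j < m ] (b i j + ⟦ A₁ (e i) (mate (e j)) ⟧)
      ≡⟨ sum-cong-≗ (λ j → trans (cong (b i j +_) (α₁-mate i j))
           (regroup (b i j) (δ i j))) ⟩
    ∑[ j < m ] (δ i j + 2 * b i j) ≡⟨ ∑-distrib-+ (δ i) (λ j → 2 * b i j) ⟩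
    ∑[ j < m ] δ i j + ∑[ j < m ] (2 * b i j)
      ≡⟨ cong₂ _+_ (sum-δ-1 i) (sym (*-distribˡ-sum 2 (b i))) ⟩
    suc (2 * degΔ i) ∎
    where
    regroup : ∀ p q → p + (p + q) ≡ q + 2 * p
    regroup = solve-∀

  -- The off-diagonal entries of `B² + (B + I)² = 2 B² + 2 B + I` count common neighbours in `Γ` of
  -- two vertices that are neither equal nor mates.
  double-common : ∀ {i j} → i ≢ j → a ≡ 2 * (b i j + cnΔ i j)
  double-common {i} {j} i≢j = begin
    a ≡⟨ common-other (g (e j)) (g (e i)) (i≢j ∘ e-injective ∘ g-injective)
           (λ eq → e-≢-mate i j (g-injective (trans eq (sym (g-mate (e j)))))) ⟨
    cn (g (e i)) (g (e j))
      ≡⟨ sum-pairs (λ x → ⟦ A₁ (e i) x ⟧ * ⟦ A₁ (e j) x ⟧) ⟩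
    ∑[ z < m ] (b i z * b j z
                + ⟦ A₁ (e i) (mate (e z)) ⟧ * ⟦ A₁ (e j) (mate (e z)) ⟧)
      ≡⟨ sum-cong-≗ (λ z → trans
           (cong (b i z * b j z +_) (cong₂ _*_ (α₁-mate i z) (α₁-mate j z)))
           (pointwise z)) ⟩
    ∑[ z < m ] (δ i z * b j z + δ j z * b i z + 2 * (b i z * b j z))
      ≡⟨ ∑-distrib-+ (λ z → δ i z * b j z + δ j z * b i z) (λ z → 2 * (b i z * b j z)) ⟩
    ∑[ z < m ] (δ i z * b j z + δ j z * b i z) + ∑[ z < m ] (2 * (b i z * b j z))
      ≡⟨ cong₂ _+_ (∑-distrib-+ (λ z → δ i z * b j z) (λ z → δ j z * b i z))
           (sym (*-distribˡ-sum 2 (λ z → b i z * b j z))) ⟩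
    ∑[ z < m ] (δ i z * b j z) + ∑[ z < m ] (δ j z * b i z) + 2 * cnΔ i j
      ≡⟨ cong (_+ 2 * cnΔ i j) (cong₂ _+_
           (trans (sum-δ i (b j)) (cong ⟦_⟧ (symmetric Δ j i))) (sum-δ j (b i))) ⟩
    b i j + b i j + 2 * cnΔ i j ≡⟨ regroup (b i j) (cnΔ i j) ⟩
    2 * (b i j + cnΔ i j) ∎
    where
    regroup : ∀ p q → p + p + 2 * q ≡ 2 * (p + q)
    regroup = solve-∀
    -- The product of the two identity terms vanishes off the diagonal.
    δδ≡0 : ∀ z → δ i z * δ j z ≡ 0
    δδ≡0 z with i ≟ z
    ... | no _     = refl
    ... | yes refl = cong (1 *_) (δ-≢ (i≢j ∘ sym))
    expand : ∀ p q r s →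
      p * q + (p + r) * (q + s) ≡ r * q + s * p + 2 * (p * q) + r * s
    expand = solve-∀
    pointwise : ∀ z → b i z * b j z + (b i z + δ i z) * (b j z + δ j z) ≡
      δ i z * b j z + δ j z * b i z + 2 * (b i z * b j z)
    pointwise z = begin
      b i z * b j z + (b i z + δ i z) * (b j z + δ j z)
        ≡⟨ expand (b i z) (b j z) (δ i z) (δ j z) ⟩
      δ i z * b j z + δ j z * b i z + 2 * (b i z * b j z) + δ i z * δ j z
        ≡⟨ cong (δ i z * b j z + δ j z * b i z + 2 * (b i z * b j z) +_) (δδ≡0 z) ⟩
      δ i z * b j z + δ j z * b i z + 2 * (b i z * b j z) + 0
        ≡⟨ +-identityʳ _ ⟩
      δ i z * b j z + δ j z * b i z + 2 * (b i z * b j z) ∎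

  common-Δ : ∀ i j → common Δ i j ≡ cnΔ i j
  common-Δ i j = ∣tabulate-∩∣ (adj Δ i) (adj Δ j)

  halve : ∀ {p} q → p ≡ 2 * q → q ≡ ⌊ p /2⌋
  halve q refl = trans (n≡⌊n+n/2⌋ q) (cong (λ z → ⌊ q + z /2⌋) (sym (+-identityʳ q)))

  -- Written in terms of `a` and `d` alone, so that they are visibly the same for all vertices of
  -- `Δ`.
  ℓ μ : ℕ
  ℓ = ⌊ a + suc d /2⌋
  μ = ⌊ a /2⌋

  degΔ≡ℓ : ∀ i → degΔ i ≡ ℓ
  degΔ≡ℓ i = halve (degΔ i) (suc-injective (double-degree i))

  cnΔ-nonadjacent : ∀ {i j} → i ≢ j → adj Δ i j ≡ false → cnΔ i j ≡ μ
  cnΔ-nonadjacent {i} {j} i≢j ij = trans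
    (cong (λ c → ⟦ c ⟧ + cnΔ i j) (sym ij))
    (halve (b i j + cnΔ i j) (double-common i≢j))

  Δ-adjacent⇒≢ : ∀ {i j} → adj Δ i j ≡ true → i ≢ j
  Δ-adjacent⇒≢ {i} ij refl with () ← trans (sym ij) (irreflexive Δ i)

  -- The source of `λ = μ - 1`: on an edge the summand `b i j` of `double-common` is 1.
  cnΔ-adjacent : ∀ {i j} → adj Δ i j ≡ true → suc (cnΔ i j) ≡ μ
  cnΔ-adjacent {i} {j} ij = trans
    (cong (λ c → ⟦ c ⟧ + cnΔ i j) (sym ij))
    (halve (b i j + cnΔ i j) (double-common (Δ-adjacent⇒≢ ij)))

  Δ-neighbour : ∀ i → ∃[ j ] adj Δ i j ≡ true
  Δ-neighbour i with degΔ i in eq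
  ... | suc _ = exists-true (adj Δ i) eq
  ... | zero  = contradiction (trans (sym (+-suc a d)) (trans
    (suc-injective (double-degree i)) (cong (2 *_) eq))) λ ()

  -- If i were adjacent to every other vertex, then the degree of a neighbour j
  -- would be 1 + cnΔ i j = μ, so that k − 1 = 2 ℓ = 2 μ = a.
  Δ-non-neighbour : ∀ i → ∃[ j ] (i ≢ j × adj Δ i j ≡ false)
  Δ-non-neighbour i with any? (λ j → ¬? (i ≟ j) ×-dec (adj Δ i j Bool.≟ false))
  ... | yes found = found
  ... | no none = contradiction (begin
    a + suc d         ≡⟨ suc-injective (double-degree j) ⟩
    2 * degΔ j        ≡⟨ cong (2 *_) degΔj ⟩
    2 * (1 + cnΔ i j) ≡⟨ cong (λ c → 2 * (⟦ c ⟧ + cnΔ i j)) ij ⟨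
    2 * (b i j + cnΔ i j) ≡⟨ double-common (Δ-adjacent⇒≢ ij) ⟨
    a                 ∎) (λ eq → m≢1+m+n a (trans (sym eq) (+-suc a d)))
    where
    j : Fin m
    j = proj₁ (Δ-neighbour i)
    ij : adj Δ i j ≡ true
    ij = proj₂ (Δ-neighbour i)
    pointwise : ∀ z → b j z ≡ δ i z * b j z + b i z * b j z
    pointwise z with i ≟ z
    ... | yes refl rewrite A₁-irreflexive (e i) =
      sym (trans (+-identityʳ _) (+-identityʳ _))
    ... | no i≢z with adj Δ i z in iz
    ...   | true  = sym (+-identityʳ _)
    ...   | false = contradiction (z , i≢z , iz) none
    degΔj : degΔ j ≡ 1 + cnΔ i j
    degΔj = begin
      degΔ j ≡⟨ sum-cong-≗ pointwise ⟩
      ∑[ z < m ] (δ i z * b j z + b i z * b j z)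
        ≡⟨ ∑-distrib-+ (λ z → δ i z * b j z) (λ z → b i z * b j z) ⟩
      ∑[ z < m ] (δ i z * b j z) + cnΔ i j
        ≡⟨ cong (_+ cnΔ i j) (sum-δ i (b j)) ⟩
      b j i + cnΔ i j
        ≡⟨ cong (λ c → ⟦ c ⟧ + cnΔ i j) (trans (symmetric Δ j i) ij) ⟩
      1 + cnΔ i j ∎

  -- The parameter `λ` is read off at one edge from `i` to `j`; by `cnΔ-adjacent` every edge gives
  -- the same value.
  Δ-base : Fin m → IsBase Δ
  Δ-base i = ℓ , cnΔ i j , μ , record
    { regular     = λ x → trans (∣tabulate∣ (adj Δ x)) (degΔ≡ℓ x)
    ; adjacent    = λ x y xy → trans (common-Δ x y)
        (suc-injective (trans (cnΔ-adjacent xy) (sym (cnΔ-adjacent ij))))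
    ; nonadjacent = λ x y x≢y xy → trans (common-Δ x y) (cnΔ-nonadjacent x≢y xy)
    ; notEdgeless = i , j , ij
    ; notComplete = i , Δ-non-neighbour i
    } , cnΔ-adjacent ij
    where
    j  = proj₁ (Δ-neighbour i)
    ij = proj₂ (Δ-neighbour i)

  -- Coordinates on `Γ` and the isomorphisms with the two constructions.

  from : Fin 2 × Fin m → Fin n
  from (zero  , i) = e i
  from (suc _ , i) = mate (e i)

  from-injective : ∀ {p q} → from p ≡ from q → p ≡ q
  from-injective {zero     , i} {zero     , j} eq = cong (zero ,_) (e-injective eq)
  from-injective {suc zero , i} {suc zero , j} eq =
    cong (suc zero ,_) (e-injective (mate-injective eq))
  from-injective {zero     , i} {suc zero , j} eq = contradiction eq (e-≢-mate i j)
  from-injective {suc zero , i} {zero     , j} eq =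
    contradiction (sym eq) (e-≢-mate j i)

  coordinates : ∀ v → ∃[ p ] from p ≡ v
  coordinates v with chosen v in cv
  ... | true  = let (i , ei≡v) = index v cv in (zero , i) , ei≡v
  ... | false =
    let (i , ei≡v′) = index (mate v) (trans (chosen-mate v) (cong not cv)) in
    (suc zero , i) , trans (cong mate ei≡v′) (mate-involutive v)

  to : Fin n → Fin 2 × Fin m
  to = proj₁ ∘ coordinates

  from∘to : ∀ v → from (to v) ≡ v
  from∘to = proj₂ ∘ coordinates

  -- Checked block by block: across the two copies of `Δ`, equal second coordinates give adjacent
  -- mates and distinct ones give twins.
  A₁-⊠ : ∀ p q → adj (construction₁ Δ) p q ≡ A₁ (from p) (from q)
  A₁-⊠ (zero , i) (zero , j) = ∨-identityʳ (adj Δ i j)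
  A₁-⊠ (suc zero , i) (suc zero , j) =
    trans (∨-identityʳ (adj Δ i j)) (sym (A₁-mate (e i) (e j)))
  A₁-⊠ (zero , i) (suc zero , j) with i ≟ j
  ... | yes refl = sym (A₁-mates (e i))
  ... | no i≢j   = sym (Δ-twinsʳ i≢j)
  A₁-⊠ (suc zero , i) (zero , j) with i ≟ j
  ... | yes refl = sym (trans (A₁-symmetric (mate (e i)) (e i)) (A₁-mates (e i)))
  ... | no i≢j   = sym (Δ-twins i≢j)

  to-from-≅ : (Γ′ : Graph (Fin 2 × Fin m)) →
    (∀ p q → adj Γ′ p q ≡ A (from p) (from q)) → Γ ≅ Γ′
  to-from-≅ Γ′ eq = record
    { bijection = mk↔ₛ′ to from (λ p → from-injective (from∘to (from p))) from∘to
    ; preserves = λ u v → trans (eq (to u) (to v)) (cong₂ A (from∘to u) (from∘to v))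
    }

  -- The action of `g` on pairs of mates. Since `g` preserves the chosen vertices, it leaves the
  -- `Fin 2` coordinate alone and becomes `map₂ σ`.
  σ : Fin m → Fin m
  σ i = proj₁ (index (g (e i)) (trans (chosen-g (e i)) (e-chosen i)))

  e-σ : ∀ i → e (σ i) ≡ g (e i)
  e-σ i = proj₂ (index (g (e i)) (trans (chosen-g (e i)) (e-chosen i)))

  from-σ : ∀ p → from (map₂ σ p) ≡ g (from p)
  from-σ (zero     , i) = e-σ i
  from-σ (suc zero , i) = trans (cong mate (e-σ i)) (sym (g-mate (e i)))

  σ-switching : ∃[ i ] σ i ≢ i → IsSwitchingInvolution Δ σ
  σ-switching nontrivial = record
    { automorphism = λ i j → trans (cong₂ A₁ (e-σ i) (e-σ j))
        (g-automorphism (g (e i)) (e j))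
    ; involutive   = λ i → e-injective (trans (e-σ (σ i))
        (trans (cong g (e-σ i)) (g-involutive (e i))))
    ; nontrivial   = nontrivial
    -- `A₁ (e i) (g (e i))` is by definition the diagonal entry of `A` at `g (e i)`.
    ; interchanges = λ i → trans (cong (A₁ (e i)) (e-σ i)) (irreflexive Γ (g (e i)))
    }

  -- Switching `A₁` with the involution `g` once more restores `A`.
  ≅-construction₂ : (s : IsSwitchingInvolution Δ σ) → Γ ≅ construction₂ Δ {σ} s
  ≅-construction₂ s = to-from-≅ (construction₂ Δ {σ} s) λ p q → begin
    adj (construction₁ Δ) (map₂ σ p) q  ≡⟨ A₁-⊠ (map₂ σ p) q ⟩
    A₁ (from (map₂ σ p)) (from q)       ≡⟨ cong (λ x → A₁ x (from q)) (from-σ p) ⟩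
    A₁ (g (from p)) (from q)            ≡⟨ g-A₁ (from p) (from q) ⟩
    A (from p) (from q)                 ∎

  -- If `σ` is the identity, so is `g`, and `A₁` is already `A`.
  ≅-construction₁ : (∀ i → σ i ≡ i) → Γ ≅ construction₁ Δ
  ≅-construction₁ fixed = to-from-≅ (construction₁ Δ) λ p q → begin
    adj (construction₁ Δ) p q      ≡⟨ A₁-⊠ p q ⟩
    A (g (from p)) (from q)        ≡⟨ cong (λ x → A x (from q)) (from-σ p) ⟨
    A (from (map₂ σ p)) (from q)
      ≡⟨ cong (λ i → A (from (proj₁ p , i)) (from q)) (fixed (proj₂ p)) ⟩
    A (from p) (from q)            ∎

  fixed⇒construction₁ : Fin m → (∀ i → σ i ≡ i) → FromConstruction₁ Γ
  fixed⇒construction₁ i fixed = m , Δ , Δ-base i , ≅-construction₁ fixed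

  moved⇒construction₂ : Fin m → IsSwitchingInvolution Δ σ → FromConstruction₂ Γ
  moved⇒construction₂ i s =
    ≅⇒construction₂ {Δ = Δ} {σ = σ} (Δ-base i) s (≅-construction₂ s)

  -- A switching involution must move a vertex, so the construction is decided by whether `σ` is the
  -- identity. The vertex `v` yields a vertex of `Δ` for `Δ-base`.
  from-construction : Fin n → FromConstruction₁ Γ ⊎ FromConstruction₂ Γ
  from-construction v = by-cases (any? (λ i → ¬? (σ i ≟ i)))
    where
    by-cases : Dec (∃[ i ] σ i ≢ i) → FromConstruction₁ Γ ⊎ FromConstruction₂ Γ
    by-cases (yes moved) =
      inj₂ (moved⇒construction₂ (proj₂ (to v)) (σ-switching moved))
    by-cases (no fixed)  = inj₁ (fixed⇒construction₁ (proj₂ (to v))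
      λ i → decidable-stable (σ i ≟ i) (λ neq → fixed (i , neq)))

-- From the Deza parameters to the matched graph.

theorem2 : ∀ (n : ℕ) .{{_ : NonZero n}} (Γ : Graph (Fin n)) (k a : ℕ) →
    IsDeza Γ k (k ∸ 1) a →
    k > 1 →
    (∀ v → β Γ (k ∸ 1) v ≡ 1) →
    FromConstruction₁ Γ ⊎ FromConstruction₂ Γ
-- From here on `k` is the degree minus 2, so `b` is `suc k`.
theorem2 n Γ (suc (suc k)) a deza (s≤s (s≤s z≤n)) β≡1 =
  MatchedGraph.from-construction Γ a d degree mate mate-≢
    (λ v → trans (sym (common-sum (mate v) v))
      (trans (common-sym (mate v) v) (trans (common-mate v) k≡a+1+d)))
    common-other v₀
  where
  open IsDeza deza

  v₀ : Fin n
  v₀ = fromℕ< (ℕ.>-nonZero⁻¹ n)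

  common-sum : ∀ v w →
    common Γ v w ≡ ∑[ x < n ] (⟦ adj Γ v x ⟧ * ⟦ adj Γ w x ⟧)
  common-sum v w = ∣tabulate-∩∣ (adj Γ v) (adj Γ w)

  common-sym : ∀ v w → common Γ v w ≡ common Γ w v
  common-sym v w = cong ∣_∣ (∩-comm (N Γ v) (N Γ w))

  common-refl : ∀ v → common Γ v v ≡ suc (suc k)
  common-refl v = trans (cong ∣_∣ (∩-idem (N Γ v))) (regular v)

  mates : ∀ v → ∃[ u ] (does (common Γ v u ℕ.≟ suc k) ≡ true ×
    ∀ w → does (common Γ v w ℕ.≟ suc k) ≡ true → w ≡ u)
  mates v = unique-true (λ u → does (common Γ v u ℕ.≟ suc k))
    (trans (sym (∣tabulate∣ (λ u → does (common Γ v u ℕ.≟ suc k)))) (β≡1 v))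

  mate : Fin n → Fin n
  mate v = proj₁ (mates v)

  common-mate : ∀ v → common Γ v (mate v) ≡ suc k
  common-mate v = ≡ᵇ⇒≡ (common Γ v (mate v)) (suc k)
    (Equivalence.from T-≡ (proj₁ (proj₂ (mates v))))

  mate-unique : ∀ {v w} → common Γ v w ≡ suc k → w ≡ mate v
  mate-unique {v} {w} eq = proj₂ (proj₂ (mates v)) w
    (dec-true (common Γ v w ℕ.≟ suc k) eq)

  -- A vertex shares `suc (suc k)` neighbours with itself, one more than with its mate.
  mate-≢ : ∀ v → mate v ≢ v
  mate-≢ v eq = 1+n≢n (trans (sym (common-refl v))
    (trans (cong (common Γ v) (sym eq)) (common-mate v)))

  degree′ : ∀ v → ∑[ x < n ] ⟦ adj Γ v x ⟧ ≡ suc (suc k)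
  degree′ v = trans (sym (∣tabulate∣ (adj Γ v))) (regular v)

  -- If `a = b`, every other vertex would be the mate of `v₀`; but `v₀` has at least two neighbours.
  a≢1+k : a ≢ suc k
  a≢1+k refl with exists-other (adj Γ v₀) (mate v₀) (degree′ v₀)
  ... | x , x≢v₀′ , adjacent with a-or-b v₀ x
    (λ { refl → contradiction (trans (sym adjacent) (irreflexive Γ v₀)) λ () })
  ...   | inj₁ eq = x≢v₀′ (mate-unique eq)
  ...   | inj₂ eq = x≢v₀′ (mate-unique eq)

  difference : ∃[ d ] suc a + d ≡ suc k
  difference = m≤n⇒∃[o]m+o≡n (≤∧≢⇒< a≤b a≢1+k)

  d : ℕ
  d = proj₁ difference

  k≡a+1+d : suc k ≡ a + suc d
  k≡a+1+d = trans (sym (proj₂ difference)) (sym (+-suc a d))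

  degree : ∀ v → ∑[ x < n ] ⟦ adj Γ v x ⟧ ≡ suc (a + suc d)
  degree v = trans (degree′ v) (cong suc k≡a+1+d)

  common-other : ∀ v w → w ≢ v → w ≢ mate v →
    ∑[ x < n ] (⟦ adj Γ w x ⟧ * ⟦ adj Γ v x ⟧) ≡ a
  common-other v w w≢v w≢v′ with a-or-b w v w≢v
  ... | inj₁ eq = trans (sym (common-sum w v)) eq
  ... | inj₂ eq = contradiction (mate-unique (trans (common-sym v w) eq)) w≢v′
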